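{- Let $G$ be a graph with $n$ vertices and $m$ edges. Then $G$ is graceful if and only if $n\leqslant m+1$ and the vertices of $\widehat{G}$ can be arranged (ordered) in such a way that the adjacency matrix of $\widehat{G}$ becomes graceful.
   Context: Graphs are finite, simple and undirected. A graph $G=(V,E)$ with $m$ edges is graceful if there is an injective map $f:V\to\{0,1,\ldots,m\}$ such that the edge labels $|f(u)-f(v)|$, $uv\in E$, are pairwise distinct (such $f$ is a graceful labeling or $\beta$-labeling). If $G$ has $n\le m+1$ vertices, $\widehat{G}$ denotes the graph obtained from $G$ by adding $m+1-n$ isolated vertices. For a $p\times q$ matrix with rows indexed $1,\ldots,p$ and columns $1,\ldots,q$, the box-value of position $(i,j)$ is $p+j-i$, and for each $c=1,\ldots,p+q-1$ the set of positions with box-value $c$ is called a diagonal. A $0$-$1$ matrix is graceful if every diagonal contains at most one entry equal to $1$. -}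

module Defs where

open import Data.Bool.Base using (if_then_else_)
open import Data.Fin.Base using (Fin; toℕ)
open import Data.Fin.Patterns using (0F; 1F)
open import Data.Fin.Properties using (_<?_; +↔⊎)
open import Data.List.Base using (List; allFin; cartesianProduct; filter; length)
open import Data.Nat.Base using (ℕ; suc; _+_; _∸_; _≤_; ∣_-_∣)
open import Data.Product.Base using (Σ-syntax; _×_; _,_)
open import Data.Sum.Base using (_⊎_)
open import Data.Sum.Function.Propositional using (_⊎-↔_)
open import Data.Sum.Relation.Binary.Pointwise
  using (Pointwise; inj₁; inj₂; ⊎-symmetric; ⊎-decidable)
open import Data.Vec.Functional using (Vector)
open import Function.Bundles using (_↔_; Inverse)
open import Function.Construct.Composition using (_↔-∘_)
open import Function.Construct.Identity using (↔-id)
open import Function.Definitions using (Injective)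
open import Level using (0ℓ)
open import Relation.Binary.Construct.Never using (Never)
open import Relation.Binary.Core using (Rel)
open import Relation.Binary.Definitions using (Decidable; Irreflexive; Symmetric)
open import Relation.Binary.PropositionalEquality.Core using (_≡_; refl)
open import Relation.Nullary.Decidable.Core using (does; no; _×-dec_)

-- `enum` witnesses that there are exactly `order` vertices; nothing below
-- depends on the listing it chooses, apart from the list `edges`, where it
-- selects one orientation of each edge.
record Graph : Set₁ where
  field
    V          : Set
    order      : ℕ
    enum       : Fin order ↔ V
    Adj        : Rel V 0ℓ
    adj?       : Decidable Adj
    adj-sym    : Symmetric Adj
    adj-irrefl : Irreflexive _≡_ Adj

  edges : List (Fin order × Fin order)
  edges = filter (λ (i , j) → i <? j ×-dec adj? (Inverse.to enum i) (Inverse.to enum j))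
                 (cartesianProduct (allFin order) (allFin order))

  size : ℕ
  size = length edges

open Graph

edgeLabel : (G : Graph) → (V G → Fin (suc (size G))) → V G → V G → ℕ
edgeLabel G f u v = ∣ toℕ (f u) - toℕ (f v) ∣

-- An edge is an unordered pair, so two edges uv and xy also coincide when
-- u ≡ y and v ≡ x.
record IsGracefulLabeling (G : Graph) (f : V G → Fin (suc (size G))) : Set where
  field
    injective : Injective _≡_ _≡_ f
    distinct  : ∀ {u v x y} → Adj G u v → Adj G x y →
                edgeLabel G f u v ≡ edgeLabel G f x y →
                (u ≡ x × v ≡ y) ⊎ (u ≡ y × v ≡ x)

Graceful : Graph → Set
Graceful G = Σ[ f ∈ (V G → Fin (suc (size G))) ] IsGracefulLabeling G f

addIsolated : ℕ → Graph → Graph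
addIsolated k G = record
  { V          = V G ⊎ Fin k
  ; order      = order G + k
  ; enum       = (enum G ⊎-↔ ↔-id (Fin k)) ↔-∘ +↔⊎
  ; Adj        = Pointwise (Adj G) Never
  ; adj?       = ⊎-decidable (adj? G) (λ _ _ → no λ ())
  ; adj-sym    = ⊎-symmetric (adj-sym G) (λ ())
  ; adj-irrefl = λ { refl (inj₁ a) → adj-irrefl G refl a }
  }

-- Meaningful when order G ≤ suc (size G); otherwise the truncated
-- subtraction adds no vertices.
hat : Graph → Graph
hat G = addIsolated (suc (size G) ∸ order G) G

Matrix01 : ℕ → ℕ → Set
Matrix01 p q = Vector (Vector (Fin 2) q) p

-- Rows and columns are numbered from 1, whence the successors. The row
-- number is at most p, so the subtraction is never truncated.
boxValue : ∀ {p q} → Fin p × Fin q → ℕ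
boxValue {p} (i , j) = (p + suc (toℕ j)) ∸ suc (toℕ i)

GracefulMatrix : ∀ {p q} → Matrix01 p q → Set
GracefulMatrix {p} {q} M =
  ∀ c → 1 ≤ c → c ≤ p + q ∸ 1 →
  ∀ (i i′ : Fin p) (j j′ : Fin q) →
  boxValue (i , j) ≡ c → boxValue (i′ , j′) ≡ c →
  M i j ≡ 1F → M i′ j′ ≡ 1F →
  (i , j) ≡ (i′ , j′)

Arrangement : Graph → Set
Arrangement G = Fin (order G) ↔ V G

adjacencyMatrix : (G : Graph) → Arrangement G → Matrix01 (order G) (order G)
adjacencyMatrix G σ i j =
  if does (adj? G (Inverse.to σ i) (Inverse.to σ j)) then 1F else 0F

{-# OPTIONS --safe #-}

-- A graceful labeling and a graceful arrangement are the same data: the label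
-- of a vertex is its (0-based) position in the arrangement, and isolated
-- vertices fill the unused labels. An edge joining positions i and j gives
-- entries in (i , j) and (j , i), on the diagonals with offsets j - i and
-- i - j, so edges with equal labels are exactly those sharing a diagonal.
module Submission where

open import Defs
open import Data.Bool.Base using (if_then_else_)
open import Data.Fin.Base using (Fin; zero; suc; toℕ; cast; punchIn; punchOut; _↑ˡ_)
open import Data.Fin.Patterns using (0F; 1F)
open import Data.Fin.Permutation using (Permutation′; id; insert; insert-punchIn; _⟨$⟩ʳ_)
open import Data.Fin.Properties
  using (toℕ<n; toℕ-cast; toℕ-injective; punchOut-injective; punchIn-punchOut;
         injective⇒≤; suc-injective)
open import Data.Nat.Base using (ℕ; zero; suc; _≤_; _+_; _∸_; ∣_-_∣; ⌊_/2⌋; z≤n; s≤s)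
open import Data.Nat.Properties
  using (+-comm; +-assoc; +-suc; +-cancelˡ-≡; +-monoʳ-≤; ≤-trans; ≤-reflexive; ≤-total; <⇒≤;
         ∸-mono; ∸-monoʳ-≤; m+n∸m≡n; m∸n+n≡m; m+[n∸m]≡n; m≤m+n; n≡⌊n+n/2⌋;
         m≤n⇒∣m-n∣≡n∸m; ∣-∣-comm; ∣m+n-m+o∣≡∣n-o∣; +-commutativeSemigroup)
open import Algebra.Properties.CommutativeSemigroup +-commutativeSemigroup
  using (xy∙z≈xz∙y; x∙yz≈z∙yx)
open import Data.Product.Base using (_×_; Σ-syntax; _,_; proj₁; proj₂)
open import Data.Product.Properties using (,-injective)
open import Data.Sum.Base using (_⊎_; inj₁; inj₂)
open import Data.Sum.Properties using (inj₁-injective)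
open import Data.Sum.Relation.Binary.Pointwise using (inj₁)
open import Function.Base using (_∘_; _∋_)
open import Function.Bundles using (_⇔_; mk⇔; Equivalence; Inverse; Injection)
open import Function.Construct.Composition using (_↔-∘_)
open import Function.Construct.Symmetry using (↔-sym)
open import Function.Definitions using (Injective)
open import Function.Properties.Inverse using (↔⇒↣)
open import Relation.Binary.PropositionalEquality
  using (_≡_; _≢_; refl; sym; trans; cong; cong₂; subst₂; module ≡-Reasoning)
open import Relation.Nullary using (Dec; yes; no; does; contradiction)
open Graph using (V; order; size; enum; Adj; adj?; adj-sym; adj-irrefl)
open Inverse using (to; from; strictlyInverseˡ; strictlyInverseʳ)

-- Extending an injection to a permutation.

completePermutation : ∀ {n k} (g : Fin n → Fin (n + k)) → Injective _≡_ _≡_ g →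
  Σ[ π ∈ Permutation′ (n + k) ] (∀ i → π ⟨$⟩ʳ (i ↑ˡ k) ≡ g i)
completePermutation {zero}      g g-inj = id , λ ()
completePermutation {suc n} {k} g g-inj = insert zero (g zero) π , agrees
  where
  g0≢gs : ∀ i → g zero ≢ g (suc i)
  g0≢gs i eq with () ← g-inj eq

  rest : Σ[ π ∈ Permutation′ (n + k) ] (∀ i → π ⟨$⟩ʳ (i ↑ˡ k) ≡ punchOut (g0≢gs i))
  rest = completePermutation (λ i → punchOut (g0≢gs i))
    (λ eq → suc-injective (g-inj (punchOut-injective (g0≢gs _) (g0≢gs _) eq)))

  π : Permutation′ (n + k)
  π = proj₁ rest

  agrees : ∀ i → insert zero (g zero) π ⟨$⟩ʳ (i ↑ˡ k) ≡ g i
  agrees zero    = refl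
  agrees (suc i) = begin
    insert zero (g zero) π ⟨$⟩ʳ suc (i ↑ˡ k)  ≡⟨ insert-punchIn zero (g zero) π (i ↑ˡ k) ⟩
    punchIn (g zero) (π ⟨$⟩ʳ (i ↑ˡ k))        ≡⟨ cong (punchIn (g zero)) (proj₂ rest i) ⟩
    punchIn (g zero) (punchOut (g0≢gs i))     ≡⟨ punchIn-punchOut (g0≢gs i) ⟩
    g (suc i)                                 ∎
    where open ≡-Reasoning

-- Absolute differences and signed offsets.

∣m-n∣+m≡n∨∣m-n∣+n≡m : ∀ m n → (∣ m - n ∣ + m ≡ n) ⊎ (∣ m - n ∣ + n ≡ m)
∣m-n∣+m≡n∨∣m-n∣+n≡m m n with ≤-total m n
... | inj₁ m≤n = inj₁ (trans (cong (_+ m) (m≤n⇒∣m-n∣≡n∸m m≤n)) (m∸n+n≡m m≤n))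
... | inj₂ n≤m = inj₂ (trans (cong (_+ n) (trans (∣-∣-comm m n) (m≤n⇒∣m-n∣≡n∸m n≤m)))
                             (m∸n+n≡m n≤m))

-- b + c ≡ d + a stands for b - a ≡ d - c, free of truncated subtraction.
∣a-b∣≡∣c-d∣⇒offsets : ∀ a b c d → ∣ a - b ∣ ≡ ∣ c - d ∣ →
  (b + c ≡ d + a) ⊎ (b + d ≡ c + a)
∣a-b∣≡∣c-d∣⇒offsets a b c d eq
  with ∣ a - b ∣ | ∣m-n∣+m≡n∨∣m-n∣+n≡m a b | ∣ c - d ∣ | ∣m-n∣+m≡n∨∣m-n∣+n≡m c d | eq
-- Each `refl` writes the larger end of a pair as the common distance `e` plus the smaller end.
-- Pairs oriented alike give equal offsets, pairs oriented oppositely give opposite ones.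
... | e | inj₁ refl | .e | inj₁ refl | refl = inj₁ (xy∙z≈xz∙y e a c)
... | e | inj₁ refl | .e | inj₂ refl | refl = inj₂ (xy∙z≈xz∙y e a d)
... | e | inj₂ refl | .e | inj₁ refl | refl = inj₂ (x∙yz≈z∙yx b e c)
... | e | inj₂ refl | .e | inj₂ refl | refl = inj₁ (x∙yz≈z∙yx b e d)

-- A common shift preserves distance: moving `a`, `b` by `c` and `c`, `d` by `a` gives both pairs
-- the same first end, and the hypothesis identifies the second ends.
offset⇒∣a-b∣≡∣c-d∣ : ∀ a b c d → b + c ≡ d + a → ∣ a - b ∣ ≡ ∣ c - d ∣
offset⇒∣a-b∣≡∣c-d∣ a b c d eq = begin
  ∣ a - b ∣          ≡⟨ ∣m+n-m+o∣≡∣n-o∣ c a b ⟨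
  ∣ c + a - c + b ∣  ≡⟨ cong₂ ∣_-_∣ (+-comm c a) (trans (+-comm c b) (trans eq (+-comm d a))) ⟩
  ∣ a + c - a + d ∣  ≡⟨ ∣m+n-m+o∣≡∣n-o∣ a c d ⟩
  ∣ c - d ∣          ∎
  where open ≡-Reasoning

n+n-injective : ∀ {m n} → m + m ≡ n + n → m ≡ n
n+n-injective {m} {n} eq =
  trans (n≡⌊n+n/2⌋ m) (trans (cong ⌊_/2⌋ eq) (sym (n≡⌊n+n/2⌋ n)))

-- Box-values and diagonals.

-- Trades the truncated subtraction for a plain sum, so that diagonals can be compared by
-- cancellation. The successors of the one-based numbering cancel, and the row index is below `p`.
boxValue-offset : ∀ {p q} (i : Fin p) (j : Fin q) →
  boxValue (i , j) + toℕ i ≡ p + toℕ j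
boxValue-offset {p} i j rewrite +-suc p (toℕ j) =
  m∸n+n≡m (≤-trans (<⇒≤ (toℕ<n i)) (m≤m+n p (toℕ j)))

sameDiagonal⇒offset : ∀ {p q} (i i′ : Fin p) (j j′ : Fin q) →
  boxValue (i , j) ≡ boxValue (i′ , j′) → toℕ j + toℕ i′ ≡ toℕ j′ + toℕ i
sameDiagonal⇒offset {p} i i′ j j′ eq = +-cancelˡ-≡ p _ _ (begin
  p + (toℕ j + toℕ i′)               ≡⟨ +-assoc p _ _ ⟨
  p + toℕ j + toℕ i′                 ≡⟨ cong (_+ toℕ i′) (boxValue-offset i j) ⟨
  boxValue (i , j) + toℕ i + toℕ i′  ≡⟨ xy∙z≈xz∙y (boxValue (i , j)) _ _ ⟩
  boxValue (i , j) + toℕ i′ + toℕ i  ≡⟨ cong (λ c → c + toℕ i′ + toℕ i) eq ⟩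
  boxValue (i′ , j′) + toℕ i′ + toℕ i ≡⟨ cong (_+ toℕ i) (boxValue-offset i′ j′) ⟩
  p + toℕ j′ + toℕ i                 ≡⟨ +-assoc p _ _ ⟩
  p + (toℕ j′ + toℕ i)               ∎)
  where open ≡-Reasoning

offset⇒sameDiagonal : ∀ {p q} (i i′ : Fin p) (j j′ : Fin q) →
  toℕ j + toℕ i′ ≡ toℕ j′ + toℕ i → boxValue (i , j) ≡ boxValue (i′ , j′)
offset⇒sameDiagonal {p} i i′ j j′ eq =
  +-cancelˡ-≡ (toℕ i + toℕ i′) _ _ (begin
    toℕ i + toℕ i′ + boxValue (i , j)    ≡⟨ +-comm _ (boxValue (i , j)) ⟩
    boxValue (i , j) + (toℕ i + toℕ i′)  ≡⟨ +-assoc (boxValue (i , j)) _ _ ⟨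
    boxValue (i , j) + toℕ i + toℕ i′    ≡⟨ cong (_+ toℕ i′) (boxValue-offset i j) ⟩
    p + toℕ j + toℕ i′                   ≡⟨ +-assoc p _ _ ⟩
    p + (toℕ j + toℕ i′)                 ≡⟨ cong (p +_) eq ⟩
    p + (toℕ j′ + toℕ i)                 ≡⟨ +-assoc p _ _ ⟨
    p + toℕ j′ + toℕ i                   ≡⟨ cong (_+ toℕ i) (boxValue-offset i′ j′) ⟨
    boxValue (i′ , j′) + toℕ i′ + toℕ i  ≡⟨ +-assoc (boxValue (i′ , j′)) _ _ ⟩
    boxValue (i′ , j′) + (toℕ i′ + toℕ i) ≡⟨ cong (boxValue (i′ , j′) +_) (+-comm (toℕ i′) _) ⟩
    boxValue (i′ , j′) + (toℕ i + toℕ i′) ≡⟨ +-comm (boxValue (i′ , j′)) _ ⟩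
    toℕ i + toℕ i′ + boxValue (i′ , j′)  ∎)
  where open ≡-Reasoning

-- With the upper bound that follows, this shows that the range of `c` in `GracefulMatrix` reaches
-- every position. The box-value is least in the last row, where it is `suc (toℕ j)`.
1≤boxValue : ∀ {p q} (i : Fin p) (j : Fin q) → 1 ≤ boxValue (i , j)
1≤boxValue {p} i j =
  ≤-trans (s≤s z≤n)
    (≤-trans (≤-reflexive (sym (m+n∸m≡n p (suc (toℕ j)))))
             (∸-monoʳ-≤ (p + suc (toℕ j)) (toℕ<n i)))

boxValue≤p+q∸1 : ∀ {p q} (i : Fin p) (j : Fin q) → boxValue (i , j) ≤ p + q ∸ 1
boxValue≤p+q∸1 {p} i j = ∸-mono (+-monoʳ-≤ p (toℕ<n j)) (s≤s (z≤n {toℕ i}))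

-- Graceful adjacency matrices in terms of offsets.

indicator≡1F⇔ : ∀ {a} {A : Set a} (A? : Dec A) →
  (if does A? then 1F else 0F) ≡ (Fin 2 ∋ 1F) ⇔ A
indicator≡1F⇔ (yes a) = mk⇔ (λ _ → a) (λ _ → refl)
indicator≡1F⇔ (no ¬a) = mk⇔ (λ ()) (λ a → contradiction a ¬a)

-- The equation stands for j - i ≡ j′ - i′. Pairs are ordered, so each edge counts once for each of
-- its two matrix entries.
OffsetsDistinct : (H : Graph) → Arrangement H → Set
OffsetsDistinct H σ = ∀ {i j i′ j′} →
  Adj H (to σ i) (to σ j) → Adj H (to σ i′) (to σ j′) →
  toℕ j + toℕ i′ ≡ toℕ j′ + toℕ i → (i , j) ≡ (i′ , j′)

gracefulMatrix⇔offsetsDistinct : (H : Graph) (σ : Arrangement H) →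
  GracefulMatrix (adjacencyMatrix H σ) ⇔ OffsetsDistinct H σ
gracefulMatrix⇔offsetsDistinct H σ = mk⇔
  (λ graceful {i} {j} {i′} {j′} adj adj′ eq →
    graceful (boxValue (i , j)) (1≤boxValue i j) (boxValue≤p+q∸1 i j)
      i i′ j j′ refl (sym (offset⇒sameDiagonal i i′ j j′ eq))
      (entry.from adj) (entry.from adj′))
  (λ distinct c _ _ i i′ j j′ box box′ one one′ →
    distinct (entry.to one) (entry.to one′)
      (sameDiagonal⇒offset i i′ j j′ (trans box (sym box′))))
  where
  module entry {i j} = Equivalence (indicator≡1F⇔ (adj? H (to σ i) (to σ j)))

-- `Pointwise` relates no vertex of `G` to an added one, and `Never` relates no two added ones.
addIsolated-edge : ∀ k (G : Graph) {s t} → Adj (addIsolated k G) s t →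
  Σ[ u ∈ V G ] Σ[ v ∈ V G ] (s ≡ inj₁ u × t ≡ inj₁ v × Adj G u v)
addIsolated-edge k G (inj₁ uv) = _ , _ , refl , refl , uv

module _ (G : Graph) where

  private
    n m k : ℕ
    n = order G
    m = size G
    k = suc m ∸ n

  -- From a graceful labeling to an arrangement.

  module _ (f : V G → Fin (suc m)) (graceful : IsGracefulLabeling G f) where
    open IsGracefulLabeling graceful

    order≤1+size : n ≤ suc m
    order≤1+size = injective⇒≤ (Injection.injective (↔⇒↣ (enum G)) ∘ injective)

    private
      n+k≡1+m : n + k ≡ suc m
      n+k≡1+m = m+[n∸m]≡n order≤1+size

      place : Fin n → Fin (n + k)
      place = cast (sym n+k≡1+m) ∘ f ∘ to (enum G)

      toℕ-place : ∀ i → toℕ (place i) ≡ toℕ (f (to (enum G) i))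
      toℕ-place i = toℕ-cast _ (f (to (enum G) i))

      place-injective : Injective _≡_ _≡_ place
      place-injective {i} {j} eq =
        Injection.injective (↔⇒↣ (enum G)) (injective (toℕ-injective
          (trans (sym (toℕ-place i)) (trans (cong toℕ eq) (toℕ-place j)))))

      completed : Σ[ π ∈ Permutation′ (n + k) ] (∀ i → π ⟨$⟩ʳ (i ↑ˡ k) ≡ place i)
      completed = completePermutation place place-injective

    -- The completed permutation sends the index of a vertex to its label, so its inverse is what
    -- turns a position into a vertex.
    labelArrangement : Arrangement (hat G)
    labelArrangement = enum (hat G) ↔-∘ ↔-sym (proj₁ completed)

    labelArrangement-position : ∀ {i v} →
      to labelArrangement i ≡ inj₁ v → toℕ i ≡ toℕ (f v)
    labelArrangement-position {i} {v} eq = begin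
      toℕ i                                  ≡⟨ cong toℕ (strictlyInverseʳ labelArrangement i) ⟨
      toℕ (from labelArrangement (to labelArrangement i))
                                             ≡⟨ cong (toℕ ∘ from labelArrangement) eq ⟩
      -- The left side computes to the completed permutation at the index of `v` embedded by `_↑ˡ_`,
      -- where it agrees with `place`.
      toℕ (from labelArrangement (inj₁ v))   ≡⟨ cong toℕ (proj₂ completed (from (enum G) v)) ⟩
      toℕ (place (from (enum G) v))          ≡⟨ toℕ-place _ ⟩
      toℕ (f (to (enum G) (from (enum G) v)))
                                             ≡⟨ cong (toℕ ∘ f) (strictlyInverseˡ (enum G) v) ⟩
      toℕ (f v)                              ∎
      where open ≡-Reasoning

    private
      edge-unique : ∀ {u v x y} → Adj G u v → Adj G x y →
        toℕ (f v) + toℕ (f x) ≡ toℕ (f y) + toℕ (f u) → u ≡ x × v ≡ y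
      edge-unique {u} {v} {x} {y} adj adj′ eq
        with distinct adj adj′
               (offset⇒∣a-b∣≡∣c-d∣ (toℕ (f u)) (toℕ (f v)) (toℕ (f x)) (toℕ (f y)) eq)
      ... | inj₁ same          = same
      -- A reversed edge has the opposite offset, so it would have to be a loop.
      ... | inj₂ (refl , refl) = contradiction adj
        (adj-irrefl G (sym (injective (toℕ-injective (n+n-injective eq)))))

    labelArrangement-offsetsDistinct : OffsetsDistinct (hat G) labelArrangement
    labelArrangement-offsetsDistinct adj adj′ eq =
      let u , v , σi  , σj  , uv = addIsolated-edge k G adj
          x , y , σi′ , σj′ , xy = addIsolated-edge k G adj′
          u≡x , v≡y = edge-unique uv xy
            (subst₂ _≡_ (cong₂ _+_ (position σj) (position σi′))
                        (cong₂ _+_ (position σj′) (position σi)) eq)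
      in cong₂ _,_ (σ-injective (trans σi (trans (cong inj₁ u≡x) (sym σi′))))
                   (σ-injective (trans σj (trans (cong inj₁ v≡y) (sym σj′))))
      where
      position = labelArrangement-position
      σ-injective = Injection.injective (↔⇒↣ labelArrangement)

  -- From an arrangement to a graceful labeling.

  module _ (n≤1+m : n ≤ suc m) (σ : Arrangement (hat G))
           (offsetsDistinct : OffsetsDistinct (hat G) σ) where

    positionLabeling : V G → Fin (suc m)
    -- The bound `n≤1+m` keeps the subtraction in `k` from truncating, so there are exactly `suc m`
    -- positions.
    positionLabeling v = cast (m+[n∸m]≡n n≤1+m) (from σ (inj₁ v))

    private
      position : V G → ℕ
      position v = toℕ (from σ (inj₁ v))

      toℕ-positionLabeling : ∀ v → toℕ (positionLabeling v) ≡ position v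
      toℕ-positionLabeling v = toℕ-cast _ (from σ (inj₁ v))

      from-injective : Injective _≡_ _≡_ (from σ)
      from-injective = Injection.injective (↔⇒↣ (↔-sym σ))

      position-injective : Injective _≡_ _≡_ position
      position-injective = inj₁-injective ∘ from-injective ∘ toℕ-injective

      edge-unique : ∀ {u v x y} → Adj G u v → Adj G x y →
        position v + position x ≡ position y + position u → u ≡ x × v ≡ y
      edge-unique adj adj′ eq =
        let p , q = ,-injective (offsetsDistinct (arranged adj) (arranged adj′) eq)
        in position-injective (cong toℕ p) , position-injective (cong toℕ q)
        where
        arranged : ∀ {u v} → Adj G u v →
          Adj (hat G) (to σ (from σ (inj₁ u))) (to σ (from σ (inj₁ v)))
        arranged {u} {v} adj = subst₂ (Adj (hat G))
          (sym (strictlyInverseˡ σ (inj₁ u))) (sym (strictlyInverseˡ σ (inj₁ v))) (inj₁ adj)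

    positionLabeling-graceful : IsGracefulLabeling G positionLabeling
    positionLabeling-graceful = record
      { injective = λ {u} {v} eq → position-injective
          (trans (sym (toℕ-positionLabeling u)) (trans (cong toℕ eq) (toℕ-positionLabeling v)))
      ; distinct  = distinct
      }
      where
      label≡ : ∀ u v → edgeLabel G positionLabeling u v ≡ ∣ position u - position v ∣
      label≡ u v = cong₂ ∣_-_∣ (toℕ-positionLabeling u) (toℕ-positionLabeling v)

      distinct : ∀ {u v x y} → Adj G u v → Adj G x y →
        edgeLabel G positionLabeling u v ≡ edgeLabel G positionLabeling x y →
        (u ≡ x × v ≡ y) ⊎ (u ≡ y × v ≡ x)
      distinct {u} {v} {x} {y} adj adj′ eq
        with ∣a-b∣≡∣c-d∣⇒offsets (position u) (position v) (position x) (position y)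
               (trans (sym (label≡ u v)) (trans eq (label≡ x y)))
      ... | inj₁ offset = inj₁ (edge-unique adj adj′ offset)
      -- Opposite offsets become equal when the second edge is read backwards, that is, at its
      -- mirrored matrix entry; hence the swapped endpoints.
      ... | inj₂ offset = inj₂ (edge-unique adj (adj-sym G adj′) offset)

theorem2p3 : (G : Graph) →
    Graceful G ⇔
    (order G ≤ size G + 1 ×
    (Σ[ σ ∈ Arrangement (hat G) ] GracefulMatrix (adjacencyMatrix (hat G) σ)))
theorem2p3 G = mk⇔
  (λ (f , graceful) →
    ≤-trans (order≤1+size G f graceful) (≤-reflexive (+-comm 1 (size G))) ,
    labelArrangement G f graceful ,
    Equivalence.from (gracefulMatrix⇔offsetsDistinct (hat G) (labelArrangement G f graceful))
      (labelArrangement-offsetsDistinct G f graceful))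
  (λ (n≤m+1 , σ , graceful) →
    let n≤1+m    = ≤-trans n≤m+1 (≤-reflexive (+-comm (size G) 1))
        distinct = Equivalence.to (gracefulMatrix⇔offsetsDistinct (hat G) σ) graceful
    in positionLabeling G n≤1+m σ distinct , positionLabeling-graceful G n≤1+m σ distinct)
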